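{- For every integer $k\ge 2$ we have $B(n)=0$ for all integers $n$ with $A(k)+1\le n\le 2^k-1$. These indices form a run of zeros of length $A(k-1)$ in the sequence $B$, and these runs (one for each $k\ge 2$) are precisely the runs of zeros of record length in $B$.
   Context: The sequence $A$ (OEIS A000975: $1,2,5,10,21,42,85,\dots$) is defined by $A(1)=1$, $A(2m)=2A(2m-1)$ and $A(2m+1)=2A(2m)+1$ for $m\ge 1$. The sequence $B$ (OEIS A265158) is defined on positive integers by $B(1)=1$, and for $n\ge 1$, $B(2n)=2B(n)$ and $B(2n+1)=\lfloor B(n)/2\rfloor$. A run of zeros in $B$ is a maximal (nonempty) block of consecutive indices $n$ with $B(n)=0$; its length is the number of indices in it. A run of zeros is of record length if it is strictly longer than every run of zeros occurring earlier in the sequence (the first run of zeros counts as a record). -}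

module Defs where

open import Data.Nat using (ℕ; zero; suc; _+_; _*_; _∸_; _≤_; _<_; NonZero; s≤s; z≤n)
open import Data.Nat.DivMod
  using (_/_; _%_; m/n<m; m*n/n≡m; m*n%n≡0; [m+kn]%n≡m%n; +-distrib-/-∣ʳ)
open import Data.Nat.Divisibility using (divides-refl)
open import Data.Nat.Induction using (<-rec; <-wellFounded; <-Rec)
open import Data.Nat.Properties using (+-comm; +-identityʳ; *-comm)
open import Data.Product using (_×_)
open import Induction.WellFounded using (module FixPoint)
open import Relation.Binary.PropositionalEquality
  using (_≡_; refl; trans; cong; cong₂; subst)

-- Both sequences are indexed by the positive integers; their values at 0 are
-- placeholders.  The defining recurrences are A-one, A-even, A-odd and
-- B-one, B-even, B-odd below.

A : ℕ → ℕ
A zero    = 0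
A (suc n) = 2 * A n + suc n % 2

A-one : A 1 ≡ 1
A-one = refl

A-even : ∀ m .{{_ : NonZero m}} → A (2 * m) ≡ 2 * A (2 * m ∸ 1)
A-even m@(suc _) = trans (cong (2 * A (2 * m ∸ 1) +_) even) (+-identityʳ _)
  where
  even : (2 * m) % 2 ≡ 0
  even = trans (cong (_% 2) (*-comm 2 m)) (m*n%n≡0 m 2)

A-odd : ∀ m → A (2 * m + 1) ≡ 2 * A (2 * m) + 1
A-odd m = subst (λ i → A i ≡ 2 * A (2 * m) + 1) (+-comm 1 (2 * m))
            (cong (2 * A (2 * m) +_) odd)
  where
  odd : suc (2 * m) % 2 ≡ 1
  odd = trans (cong (λ i → suc i % 2) (*-comm 2 m)) ([m+kn]%n≡m%n 1 m 2)

-- The value at n, given its residue mod 2 and the value at ⌊ n / 2 ⌋.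
B-next : ℕ → ℕ → ℕ
B-next zero    b = 2 * b
B-next (suc _) b = b / 2

B-step : ∀ n → <-Rec (λ _ → ℕ) n → ℕ
B-step 0               _   = 0
B-step 1               _   = 1
B-step n@(suc (suc _)) rec = B-next (n % 2) (rec (m/n<m n 2 (s≤s (s≤s z≤n))))

B : ℕ → ℕ
B = <-rec (λ _ → ℕ) B-step

B-unfold : ∀ n → B n ≡ B-step n (λ {m} _ → B m)
B-unfold n = FixPoint.unfold-wfRec <-wellFounded (λ _ → ℕ) B-step ext {n}
  where
  ext : ∀ n {f g : <-Rec (λ _ → ℕ) n} →
        (∀ {m} (m<n : m < n) → f m<n ≡ g m<n) → B-step n f ≡ B-step n g
  ext 0               _  = refl
  ext 1               _  = refl
  ext n@(suc (suc _)) eq = cong (B-next (n % 2)) (eq _)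

B-halve : ∀ n → 2 ≤ n → B n ≡ B-next (n % 2) (B (n / 2))
B-halve n@(suc (suc _)) _ = B-unfold n
B-halve 1 (s≤s ())

B-one : B 1 ≡ 1
B-one = refl

B-even : ∀ n .{{_ : NonZero n}} → B (2 * n) ≡ 2 * B n
B-even n@(suc _) = trans (cong B (*-comm 2 n)) (trans (B-halve (n * 2) (s≤s (s≤s z≤n)))
  (cong₂ (λ r q → B-next r (B q)) (m*n%n≡0 n 2) (m*n/n≡m n 2)))

B-odd : ∀ n .{{_ : NonZero n}} → B (2 * n + 1) ≡ B n / 2
B-odd n@(suc _) = trans (cong B (trans (+-comm (2 * n) 1) (cong suc (*-comm 2 n))))
  (trans (B-halve (1 + n * 2) (s≤s (s≤s z≤n)))
    (cong₂ (λ r q → B-next r (B q)) ([m+kn]%n≡m%n 1 n 2)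
      (trans (+-distrib-/-∣ʳ 1 {n * 2} {2} (divides-refl n)) (m*n/n≡m n 2))))

-- Blocks of indices are intervals a, a + 1, …, b of positive integers, given
-- by their endpoints.
record ZeroBlock (f : ℕ → ℕ) (a b : ℕ) : Set where
  field
    positive : 1 ≤ a
    nonempty : a ≤ b
    zeros    : ∀ n → a ≤ n → n ≤ b → f n ≡ 0

record ZeroRun (f : ℕ → ℕ) (a b : ℕ) : Set where
  field
    block   : ZeroBlock f a b
    maximal : ∀ c d → ZeroBlock f c d → c ≤ a → b ≤ d → c ≡ a × d ≡ b

runLength : ℕ → ℕ → ℕ
runLength a b = suc b ∸ a

record RecordZeroRun (f : ℕ → ℕ) (a b : ℕ) : Set where
  field
    run           : ZeroRun f a b
    record-length : ∀ c d → ZeroRun f c d → d < a → runLength c d < runLength a b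

{-# OPTIONS --safe #-}
module Submission where

open import Data.Empty using (⊥)
open import Data.Nat using (ℕ; zero; suc; _+_; _*_; _∸_; _^_; _≤_; _<_; _⊓_; _⊔_;
  z≤n; s≤s; ⌈_/2⌉; ⌊_/2⌋; >-nonZero)
open import Data.Nat.DivMod using (_/_; _%_; m%n<n; m≥n⇒m/n>0)
open import Data.Nat.Properties
open import Data.Nat.Tactic.RingSolver using (solve-∀)
open import Data.Product using (_×_; _,_; proj₁; proj₂; ∃-syntax)
open import Data.Sum using (_⊎_; inj₁; inj₂)
open import Function.Bundles using (_⇔_; mk⇔)
open import Relation.Binary.PropositionalEquality using (_≡_; _≢_; refl; sym; trans; cong;
  subst; module ≡-Reasoning)
open import Relation.Nullary using (yes; no; contradiction)
open import Defs

-- Passing from n to 2n and 2n + 1, a zero of B gives two zeros.  A new block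
-- starts as a single zero, and apart from doubling a block grows only by one
-- index at its left end, when B takes the value 1 just before it.  The value
-- before the grown block is then 2, and one generation later it is 1 again,
-- without growth.  So block lengths obey at best the recurrence of A, and only
-- the blocks ending at 2 ^ k - 1 descend from the first zero, B 3.

-- Halving, parity and the growth of `A`.

data Halving : ℕ → Set where
  even : ∀ m → Halving (2 * m)
  odd  : ∀ m → Halving (suc (2 * m))

halving : ∀ n → Halving n
halving zero = even 0
halving (suc n) with halving n
... | even m = odd m
... | odd m  = subst Halving (*-suc 2 m) (even (suc m))

parity : ∀ k → (k % 2 ≡ 0 × suc k % 2 ≡ 1) ⊎ (k % 2 ≡ 1 × suc k % 2 ≡ 0)
parity zero    = inj₁ (refl , refl)
parity (suc k) with parity k
... | inj₁ (p , q) = inj₂ (q , p)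
... | inj₂ (p , q) = inj₁ (q , p)

⌈n/2⌉≤m : ∀ {n m} → n ≤ 2 * m → ⌈ n /2⌉ ≤ m
⌈n/2⌉≤m {n} {m} n≤2m = begin
  ⌈ n /2⌉      ≤⟨ ⌈n/2⌉-mono n≤2m ⟩
  ⌈ 2 * m /2⌉  ≡⟨ cong (λ i → ⌈ m + i /2⌉) (+-identityʳ m) ⟩
  ⌈ m + m /2⌉  ≡⟨ sym (n≡⌈n+n/2⌉ m) ⟩
  m            ∎
  where open ≤-Reasoning

⌈n/2⌉≤m⁻¹ : ∀ {n m} → ⌈ n /2⌉ ≤ m → n ≤ 2 * m
⌈n/2⌉≤m⁻¹ {n} {m} h = begin
  n                      ≡⟨ sym (⌊n/2⌋+⌈n/2⌉≡n n) ⟩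
  ⌊ n /2⌋ + ⌈ n /2⌉      ≤⟨ +-mono-≤ (≤-trans (⌊n/2⌋≤⌈n/2⌉ n) h) h ⟩
  m + m                  ≡⟨ cong (m +_) (sym (+-identityʳ m)) ⟩
  2 * m                  ∎
  where open ≤-Reasoning

A-mono-< : ∀ k → A k < A (suc k)
A-mono-< zero    = s≤s z≤n
A-mono-< (suc k) = begin-strict
  A (suc k)           <⟨ m<m+n _ (≤-trans (≤-trans (s≤s z≤n) (A-mono-< k)) (m≤m+n _ 0)) ⟩
  2 * A (suc k)       ≤⟨ m≤m+n _ _ ⟩
  A (suc (suc k))     ∎
  where open ≤-Reasoning

n≤A : ∀ n → n ≤ A n
n≤A zero    = z≤n
n≤A (suc n) = ≤-<-trans (n≤A n) (A-mono-< n)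

A-suc≤ : ∀ k → A (suc k) ≤ suc (2 * A k)
A-suc≤ k = ≤-trans (+-monoʳ-≤ (2 * A k) (≤-pred (m%n<n (suc k) 2))) (≤-reflexive (+-comm _ 1))

parity-sum : ∀ k → k % 2 + suc k % 2 ≡ 1
parity-sum zero    = refl
parity-sum (suc k) = trans (+-comm (suc k % 2) (k % 2)) (parity-sum k)

-- Raising `k` by one doubles both terms and adds two consecutive residues mod 2, whose sum is 1.
-- This gives the length of the runs ending at `2 ^ k - 1`.
A+A≡2^k : ∀ k → suc (A (suc k) + A k) ≡ 2 ^ suc k
A+A≡2^k zero    = refl
A+A≡2^k (suc k) = begin
  suc (A (suc (suc k)) + A (suc k))                        ≡⟨ regroup (A (suc k)) (A k) (k % 2) (suc k % 2) ⟩
  suc (2 * A (suc k) + 2 * A k + (k % 2 + suc k % 2))      ≡⟨ cong (λ i → suc (2 * A (suc k) + 2 * A k + i)) (parity-sum k) ⟩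
  suc (2 * A (suc k) + 2 * A k + 1)                        ≡⟨ factor (A (suc k)) (A k) ⟩
  2 * suc (A (suc k) + A k)                                ≡⟨ cong (2 *_) (A+A≡2^k k) ⟩
  2 ^ suc (suc k)                                          ∎
  where
  open ≡-Reasoning
  regroup : ∀ a b r s → suc (2 * a + r + (2 * b + s)) ≡ suc (2 * a + 2 * b + (r + s))
  regroup = solve-∀
  factor : ∀ a b → suc (2 * a + 2 * b + 1) ≡ 2 * suc (a + b)
  factor = solve-∀

-- Values of `B` at powers of 2, at terms of `A` and between them.

B-double : ∀ m → B (2 * m) ≡ 2 * B m
B-double zero      = refl
B-double m@(suc _) = B-even m

B-suc-double : ∀ {m} → 1 ≤ m → B (suc (2 * m)) ≡ B m / 2
B-suc-double {m} 1≤m = trans (cong B (+-comm 1 (2 * m))) (B-odd m {{>-nonZero 1≤m}})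

B-2^ : ∀ k → B (2 ^ k) ≡ 2 ^ k
B-2^ zero    = refl
B-2^ (suc k) = trans (B-double (2 ^ k)) (cong (2 *_) (B-2^ k))

-- From value 1 at `a` the next term of `A` is `2 * a`, with value 2; from value 2 it is
-- `2 * a + 1`, with value 1. These nonzero values bound the final runs on the left.
B-A : ∀ k → B (A (suc k)) ≡ suc (k % 2)
B-A zero    = refl
B-A (suc k) = step (A (suc k)) (≤-trans (s≤s z≤n) (n≤A (suc k))) (parity k) (B-A k)
  where
  step : ∀ a {r s} → 1 ≤ a → (r ≡ 0 × s ≡ 1) ⊎ (r ≡ 1 × s ≡ 0) → B a ≡ suc r → B (2 * a + r) ≡ suc s
  step a _   (inj₁ (refl , refl)) Ba≡1 = trans (cong B (+-identityʳ (2 * a))) (trans (B-double a) (cong (2 *_) Ba≡1))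
  step a 1≤a (inj₂ (refl , refl)) Ba≡2 = trans (cong B (+-comm (2 * a) 1)) (trans (B-suc-double 1≤a) (cong (_/ 2) Ba≡2))

B-zero : ∀ k n → A (suc k) < n → n < 2 ^ suc k → B n ≡ 0
B-zero zero n 1<n n<2 = contradiction 1<n (<⇒≱ n<2)
B-zero (suc k) n A<n n<2^ with halving n
... | even m = trans (B-double m) (cong (2 *_) (B-zero k m
      (*-cancelˡ-< 2 _ _ (≤-<-trans (m≤m+n _ _) A<n)) (*-cancelˡ-< 2 _ _ n<2^)))
... | odd m = trans (B-suc-double 1≤m) (case-≤ (m≤n⇒m<n∨m≡n A≤m))
  where
  A≤m : A (suc k) ≤ m
  A≤m = *-cancelˡ-≤ 2 (≤-trans (m≤m+n _ _) (≤-pred A<n))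
  1≤m : 1 ≤ m
  1≤m = ≤-trans (s≤s z≤n) (≤-trans (n≤A (suc k)) A≤m)
  case-≤ : A (suc k) < m ⊎ A (suc k) ≡ m → B m / 2 ≡ 0
  case-≤ (inj₁ A<m)  = cong (_/ 2) (B-zero k m A<m (*-cancelˡ-< 2 _ _ (<-trans (n<1+n _) n<2^)))
  -- The growth at the left end: `n` is `2 * A (suc k) + 1`, which exceeds `A (2 + k)` only for even
  -- `k`; then `B m` is 1 and halves to 0.
  case-≤ (inj₂ refl) = trans (cong (_/ 2) (B-A k)) (cong (λ r → suc r / 2) k%2≡0)
    where
    k%2≡0 : k % 2 ≡ 0
    k%2≡0 = n≤0⇒n≡0 (+-cancelˡ-≤ (2 * A (suc k)) _ _
              (≤-trans (≤-pred A<n) (≤-reflexive (sym (+-identityʳ _)))))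

-- Bounding intervals of zeros by repeated halving.

-- Half-open and possibly empty, unlike `ZeroBlock`, so that intervals can be halved and shortened
-- freely.
ZeroBetween : (ℕ → ℕ) → ℕ → ℕ → Set
ZeroBetween f c e = ∀ n → c ≤ n → n < e → f n ≡ 0

-- Each `n` of the halved interval has `2 * n` in the original one, and `2 * B n` vanishes only if
-- `B n` does.
zeroBetween-halve : ∀ {m e} → ZeroBetween B (2 * m) e → ZeroBetween B m ⌈ e /2⌉
zeroBetween-halve {m} {e} z n m≤n n<e/2 =
  m+n≡0⇒m≡0 (B n) (trans (sym (B-double n))
    (z (2 * n) (*-monoʳ-≤ 2 m≤n) (≰⇒> λ e≤2n → <⇒≱ n<e/2 (⌈n/2⌉≤m e≤2n))))

zeroBetween-halve-odd : ∀ {m e} → ZeroBetween B (suc (2 * m)) e → ZeroBetween B (suc m) ⌈ e /2⌉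
zeroBetween-halve-odd {m} {e} z = zeroBetween-halve λ n 2+2m≤n n<e →
  z n (≤-trans (n≤1+n _) (≤-trans (≤-reflexive (sym (*-suc 2 m))) 2+2m≤n)) n<e

zeroBetween-extend : ∀ {f m e} → f m ≡ 0 → ZeroBetween f (suc m) e → ZeroBetween f m e
zeroBetween-extend fm≡0 z n m≤n n<e with m≤n⇒m<n∨m≡n m≤n
... | inj₁ m<n  = z n m<n n<e
... | inj₂ refl = fm≡0

-- Carries the bound on the right end through the induction of `zeroBetween-bound`.
halve-end : ∀ k {e} → e ≤ suc (A (suc k)) → ⌈ e /2⌉ ≤ suc (A k)
halve-end k e≤ = ⌈n/2⌉≤m (≤-trans e≤ (≤-trans (s≤s (A-suc≤ k)) (≤-reflexive (sym (*-suc 2 (A k))))))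

double-bound : ∀ {e m a} → ⌈ e /2⌉ ≤ m + a → e ≤ 2 * m + 2 * a
double-bound {m = m} {a} h = ≤-trans (⌈n/2⌉≤m⁻¹ h) (≤-reflexive (*-distribˡ-+ 2 m a))

double-shift : ∀ m a → 2 * suc m + 2 * a ≡ suc (2 * m) + (2 * a + 1)
double-shift = solve-∀

m/2≡0⇒m≡0∨m≡1 : ∀ {m} → m / 2 ≡ 0 → m ≡ 0 ⊎ m ≡ 1
m/2≡0⇒m≡0∨m≡1 {0} _ = inj₁ refl
m/2≡0⇒m≡0∨m≡1 {1} _ = inj₂ refl
m/2≡0⇒m≡0∨m≡1 {m@(suc (suc _))} p = contradiction (sym p) (<⇒≢ (m≥n⇒m/n>0 {m} {2} (s≤s (s≤s z≤n))))

-- The bound e ≤ c + A k stands for the truncated e ∸ c ≤ A k.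
zeroBetween-bound : ∀ k {c e} → 1 ≤ c → ZeroBetween B c e → e ≤ suc (A (2 + k)) → e ≤ c + A k
-- Here `e` is at most 3, and `B` is nonzero at 1 and 2, so the interval is empty.
zeroBetween-bound zero {c} {e} 1≤c z e≤3 = ≮⇒≥ λ c<e → absurd c 1≤c z e≤3 (≤-<-trans (m≤m+n c 0) c<e)
  where
  absurd : ∀ c → 1 ≤ c → ZeroBetween B c e → e ≤ 3 → c < e → ⊥
  absurd 1 _ z _ c<e = 1+n≢0 (z 1 ≤-refl c<e)
  absurd 2 _ z _ c<e = 1+n≢0 (z 2 ≤-refl c<e)
  absurd (suc (suc (suc _))) _ _ e≤3 c<e = <⇒≱ c<e (≤-trans e≤3 (s≤s (s≤s (s≤s z≤n))))
zeroBetween-bound (suc k) {c} {e} 1≤c z e≤ with halving c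
... | even m = begin
  e                    ≤⟨ double-bound {e} {m} (zeroBetween-bound k (1≤m m 1≤c) (zeroBetween-halve z) (halve-end (2 + k) e≤)) ⟩
  2 * m + 2 * A k      ≤⟨ +-monoʳ-≤ (2 * m) (m≤m+n _ _) ⟩
  2 * m + A (suc k)    ∎
  where
  open ≤-Reasoning
  1≤m : ∀ m → 1 ≤ 2 * m → 1 ≤ m
  1≤m (suc _) _ = s≤s z≤n
... | odd m with e ≤? suc (2 * m)
...   | yes e≤c = ≤-trans e≤c (m≤m+n _ _)
...   | no e≰c = odd-case (parity k)
  where
  open ≤-Reasoning
  c<e = ≰⇒> e≰c

  -- For `m = 0` the interval would start at index 1, where `B` is 1.
  1≤m : 1 ≤ m
  1≤m = pos m (z _ ≤-refl c<e)
    where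
    pos : ∀ m → B (suc (2 * m)) ≡ 0 → 1 ≤ m
    pos (suc _) _ = s≤s z≤n

  e/2≤ : ⌈ e /2⌉ ≤ suc (A (2 + k))
  e/2≤ = halve-end (2 + k) e≤

  from-half : ∀ {r} → ⌈ e /2⌉ ≤ m + A k → e ≤ suc (2 * m) + (2 * A k + r)
  from-half h = ≤-trans (double-bound {e} {m} h) (≤-trans (+-monoʳ-≤ (2 * m) (m≤m+n _ _)) (n≤1+n _))

  odd-case : (k % 2 ≡ 0 × suc k % 2 ≡ 1) ⊎ (k % 2 ≡ 1 × suc k % 2 ≡ 0) → e ≤ suc (2 * m) + A (suc k)
  -- Dropping the odd start before halving costs one index, which `A (suc k) = 2 * A k + 1` allows.
  odd-case (inj₁ (_ , r≡1)) = begin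
    e                                   ≤⟨ double-bound {e} {suc m} (zeroBetween-bound k (s≤s z≤n) (zeroBetween-halve-odd z) e/2≤) ⟩
    2 * suc m + 2 * A k                 ≡⟨ double-shift m (A k) ⟩
    suc (2 * m) + (2 * A k + 1)         ≡⟨ cong (λ r → suc (2 * m) + (2 * A k + r)) (sym r≡1) ⟩
    suc (2 * m) + A (suc k)             ∎
  -- Now `A (suc k) = 2 * A k` leaves no slack. The zero at the start forces `B m` to be 0, and `m`
  -- joins the halved interval, or 1, and the zeros after `m` satisfy a bound sharper by one.
  odd-case (inj₂ (k%2≡1 , _)) with m/2≡0⇒m≡0∨m≡1 (trans (sym (B-suc-double 1≤m)) (z _ ≤-refl c<e))
  ... | inj₁ Bm≡0 = from-half (zeroBetween-bound k 1≤m
          (zeroBetween-extend Bm≡0 (zeroBetween-halve-odd z)) e/2≤)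
  ... | inj₂ Bm≡1 = from-half (before-one k k%2≡1 (halving m) Bm≡1 (zeroBetween-halve-odd z) e/2≤)
    where
    -- A value 1 occurs only at odd indices, so the zeros after it start at an
    -- even index and are no more than twice their halves.
    before-one : ∀ k {m e} → k % 2 ≡ 1 → Halving m → B m ≡ 1 →
                 ZeroBetween B (suc m) e → e ≤ suc (A (2 + k)) → e ≤ m + A k
    before-one k _ (even q) Bm≡1 _ _ = contradiction (trans (sym (B-double q)) Bm≡1) (even≢1 (B q))
      where
      even≢1 : ∀ b → 2 * b ≢ 1
      even≢1 (suc b) p = 1+n≢0 (suc-injective (trans (sym (*-suc 2 b)) p))
    before-one (suc k) {e = e} k%2≡1 (odd q) _ z e≤ = begin
      e                                ≤⟨ double-bound {e} {suc q} (zeroBetween-bound k (s≤s z≤n)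
                                            (zeroBetween-halve (subst (λ c → ZeroBetween B c e) (sym (*-suc 2 q)) z))
                                            (halve-end (2 + k) e≤)) ⟩
      2 * suc q + 2 * A k              ≡⟨ double-shift q (A k) ⟩
      suc (2 * q) + (2 * A k + 1)      ≡⟨ cong (λ r → suc (2 * q) + (2 * A k + r)) (sym k%2≡1) ⟩
      suc (2 * q) + A (suc k)          ∎

-- Applied both to the runs before a final run and to those between it and the next one.
zeroBlock-length : ∀ k {a b} → ZeroBlock B a b → b ≤ A (2 + k) → runLength a b ≤ A k
zeroBlock-length k {a} {b} block b≤A = m≤n+o⇒m∸n≤o (suc b) a
  (zeroBetween-bound k positive (λ n a≤n n<1+b → zeros n a≤n (≤-pred n<1+b)) (s≤s b≤A))
  where open ZeroBlock block

-- Runs as maximal blocks, and the run ending at `2 ^ k - 1`.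

-- The union of the two is again a block of zeros, so maximality makes each run equal to it.
zeroRun-overlap : ∀ {f a b c d} → ZeroRun f a b → ZeroRun f c d → a ≤ d → c ≤ b → a ≡ c × b ≡ d
zeroRun-overlap {f} {a} {b} {c} {d} r s a≤d c≤b =
  trans (sym (proj₁ left)) (proj₁ right) , trans (sym (proj₂ left)) (proj₂ right)
  where
  module R = ZeroRun r
  module S = ZeroRun s
  module RB = ZeroBlock R.block
  module SB = ZeroBlock S.block

  zeros : ∀ n → a ⊓ c ≤ n → n ≤ b ⊔ d → f n ≡ 0
  zeros n lo hi with a ≤? n | n ≤? b
  ... | yes a≤n | yes n≤b = RB.zeros n a≤n n≤b
  ... | yes _   | no n≰b  = SB.zeros n (≤-trans c≤b (<⇒≤ (≰⇒> n≰b))) (≮⇒≥ λ d<n → <⇒≱ (⊔-lub (≰⇒> n≰b) d<n) hi)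
  ... | no a≰n  | _       = SB.zeros n (≮⇒≥ λ n<c → <⇒≱ (⊓-glb (≰⇒> a≰n) n<c) lo) (≤-trans (<⇒≤ (≰⇒> a≰n)) a≤d)

  union : ZeroBlock f (a ⊓ c) (b ⊔ d)
  union = record
    { positive = ⊓-glb RB.positive SB.positive
    ; nonempty = ≤-trans (m⊓n≤m a c) (≤-trans RB.nonempty (m≤m⊔n b d))
    ; zeros    = zeros
    }

  left  = R.maximal _ _ union (m⊓n≤m a c) (m≤m⊔n b d)
  right = S.maximal _ _ union (m⊓n≤n a c) (m≤n⊔m b d)

suc[2^k∸1]≡2^k : ∀ k → suc (2 ^ k ∸ 1) ≡ 2 ^ k
suc[2^k∸1]≡2^k k = m+[n∸m]≡n (m^n>0 2 k)

module FinalRun (j : ℕ) where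
  k = 2 + j
  a = A k + 1
  b = 2 ^ k ∸ 1

  zeros : ∀ n → a ≤ n → n ≤ b → B n ≡ 0
  zeros n a≤n n≤b = B-zero (suc j) n (≤-trans (≤-reflexive (+-comm 1 (A k))) a≤n)
    (≤-trans (s≤s n≤b) (≤-reflexive (suc[2^k∸1]≡2^k k)))

  b≡ : b ≡ A k + A (suc j)
  b≡ = cong (_∸ 1) (sym (A+A≡2^k (suc j)))

  block : ZeroBlock B a b
  block = record
    { positive = m≤n+m 1 (A k)
    ; nonempty = ≤-trans (+-monoʳ-≤ (A k) (≤-trans (s≤s z≤n) (n≤A (suc j)))) (≤-reflexive (sym b≡))
    ; zeros    = zeros
    }

  run : ZeroRun B a b
  run = record { block = block ; maximal = maximal }
    where
    maximal : ∀ c d → ZeroBlock B c d → c ≤ a → b ≤ d → c ≡ a × d ≡ b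
    -- A larger block would contain `A k`, where `B` is 1 or 2, or `2 ^ k`, where `B` is `2 ^ k`.
    maximal c d cd c≤a b≤d = ≤-antisym c≤a (≮⇒≥ c≮a) , ≤-antisym (≮⇒≥ b≮d) b≤d
      where
      module CD = ZeroBlock cd
      c≮a : c < a → ⊥
      c≮a c<a = 1+n≢0 (trans (sym (B-A (suc j)))
        (CD.zeros (A k) (≤-pred (≤-trans c<a (≤-reflexive (+-comm (A k) 1))))
          (≤-trans (m≤m+n (A k) 1) (≤-trans (ZeroBlock.nonempty block) b≤d))))
      b≮d : b < d → ⊥
      b≮d b<d = <⇒≢ (m^n>0 2 k) (sym (trans (sym (B-2^ k)) (CD.zeros (2 ^ k)
        (≤-trans c≤a (≤-trans (ZeroBlock.nonempty block) (m∸n≤m (2 ^ k) 1)))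
        (≤-trans (≤-reflexive (sym (suc[2^k∸1]≡2^k k))) b<d))))

  length : runLength a b ≡ A (suc j)
  length = trans (cong (λ i → suc i ∸ a) b≡)
    (trans (cong (suc (A k + A (suc j)) ∸_) (+-comm (A k) 1)) (m+n∸m≡n (A k) (A (suc j))))

  isRecord : RecordZeroRun B a b
  isRecord = record
    { run           = run
    -- An earlier run ends at `A (2 + j)` or before, so its length is at most `A j`, less than
    -- `A (suc j)`.
    ; record-length = λ c d cd d<a → ≤-<-trans
        (zeroBlock-length j (ZeroRun.block cd) (≤-pred (≤-trans d<a (≤-reflexive (+-comm (A k) 1)))))
        (≤-trans (A-mono-< j) (≤-reflexive (sym length)))
    }

-- Classification of the record runs.

-- Lowers `N` until `A (2 + N)` drops below `n`, which happens at the latest at `A 2 = 2`.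
A-bracket : ∀ {n} N → 2 < n → n ≤ A (2 + N) → ∃[ j ] (A (2 + j) < n × n ≤ A (3 + j))
A-bracket zero 2<n n≤2 = contradiction 2<n (≤⇒≯ n≤2)
A-bracket {n} (suc N) 2<n n≤A with n ≤? A (2 + N)
... | yes n≤A′ = A-bracket N 2<n n≤A′
... | no n≰A   = N , ≰⇒> n≰A , n≤A

B≡0⇒2<n : ∀ n → 1 ≤ n → B n ≡ 0 → 2 < n
B≡0⇒2<n (suc (suc (suc _))) _ _ = s≤s (s≤s (s≤s z≤n))

-- Bracketing the end `b` between terms of `A` selects a final run that starts no later than `b`.
-- Starting after that run, the record would be no longer than it; so the two overlap and coincide.
recordZeroRun⇒final : ∀ {a b} → RecordZeroRun B a b → ∃[ k ] (2 ≤ k × a ≡ A k + 1 × b ≡ 2 ^ k ∸ 1)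
recordZeroRun⇒final {a} {b} r
  with A-bracket b (B≡0⇒2<n b (≤-trans positive nonempty) (zeros b nonempty ≤-refl))
         (≤-trans (m≤n+m b 2) (n≤A (2 + b)))
  where open ZeroBlock (ZeroRun.block (RecordZeroRun.run r))
... | j , A<b , b≤A = 2 + j , s≤s (s≤s z≤n) , zeroRun-overlap R.run F.run (≮⇒≥ notAfter) (≤-trans (≤-reflexive (+-comm _ 1)) A<b)
  where
  module R = RecordZeroRun r
  module F = FinalRun j
  notAfter : F.b < a → ⊥
  notAfter b<a = <⇒≱ (R.record-length F.a F.b F.run b<a)
    (≤-trans (zeroBlock-length (suc j) (ZeroRun.block R.run) b≤A) (≤-reflexive (sym F.length)))

theorem4p4 : (∀ (k : ℕ) → 2 ≤ k →
    (∀ (n : ℕ) → A k + 1 ≤ n → n ≤ 2 ^ k ∸ 1 → B n ≡ 0)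
    × ZeroRun B (A k + 1) (2 ^ k ∸ 1)
    × runLength (A k + 1) (2 ^ k ∸ 1) ≡ A (k ∸ 1))
    × (∀ (a b : ℕ) →
    RecordZeroRun B a b ⇔ (∃[ k ] (2 ≤ k × a ≡ A k + 1 × b ≡ 2 ^ k ∸ 1)))
theorem4p4 = final , λ a b → mk⇔ recordZeroRun⇒final from
  where
  final : ∀ k → 2 ≤ k → _
  final (suc (suc j)) _ = FinalRun.zeros j , FinalRun.run j , FinalRun.length j
  final 1 (s≤s ())

  from : ∀ {a b} → ∃[ k ] (2 ≤ k × a ≡ A k + 1 × b ≡ 2 ^ k ∸ 1) → RecordZeroRun B a b
  from (suc (suc j) , _ , refl , refl) = FinalRun.isRecord j
  from (1 , s≤s () , _)
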